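{- Let $H_1$ and $H_2$ be vertex-disjoint finite connected simple hairy graphs with $\gamma(H_1)\geq 2$ and $\gamma(H_2)\geq 2$, let $u$ be a support vertex of $H_1$ and $v$ a support vertex of $H_2$, and let $t\geq 1$ be an integer. Let $G_t(H_1,H_2)$ be the graph with vertex set $V(H_1)\cup V(H_2)\cup\{x_1,x_2,\dots,x_t\}$, where $x_1,\dots,x_t$ are $t$ distinct new vertices, and edge set $E(H_1)\cup E(H_2)\cup\{ux_1,x_1x_2,\dots,x_{t-1}x_t,x_tv\}$. If $t=1$ or $t\equiv 0\pmod 3$, then $G_t(H_1,H_2)$ is an SR-graph.
   Context: $\gamma(G)$ denotes the domination number of a finite simple graph $G$. For an edge $e=ab$ of $G$, $G-e$ is the graph obtained by deleting $e$, and $G_e$ is the graph obtained by subdividing $e$: delete $e$, add a new vertex $w$ and the edges $aw$ and $wb$. A finite connected simple graph $G$ of order at least two is an SR-graph (sub-removable graph) if $\gamma(G-e)=\gamma(G_e)$ for every edge $e$ of $G$. A leaf is a vertex of degree $1$; a support vertex is a vertex adjacent to a leaf. A graph is a hairy graph if each of its vertices is a leaf or a support vertex. -}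

module Defs where

open import Data.Empty using (⊥)
open import Data.Fin.Base using (Fin; toℕ)
open import Data.Fin.Properties using (+↔⊎; 1↔⊤; all?; any?; inj⇒≟)
open import Data.Fin.Subset using (Subset; _∈_; ∣_∣; ⊤)
open import Data.Fin.Subset.Properties using (_∈?_; anySubset?; ∈⊤)
open import Data.Nat.Base using (ℕ; zero; suc; _+_; _≤_; z≤n; s≤s)
open import Data.Nat.Properties as ℕ using ()
open import Data.Product.Base using (∃; ∃-syntax; _×_; _,_; proj₁; proj₂)
open import Data.Sum.Base using (_⊎_; inj₁; inj₂; swap)
open import Data.Sum.Function.Propositional using (_⊎-↔_)
import Data.Unit.Base as Unit
open import Data.Vec.Base using (tabulate)
open import Function.Base using (_∘_)
open import Function.Bundles using (_↔_; module Inverse)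
open import Function.Construct.Composition using (_↔-∘_)
open import Function.Construct.Identity using (↔-id)
open import Function.Construct.Symmetry using (↔-sym)
open import Function.Properties.Inverse using (↔⇒↣)
open import Relation.Binary.Construct.Closure.ReflexiveTransitive using (Star)
open import Relation.Binary.Definitions
  using (Decidable; DecidableEquality; Irreflexive; Symmetric)
open import Relation.Binary.PropositionalEquality
  using (_≡_; refl; sym; subst)
open import Relation.Nullary.Decidable
  using (yes; no; does; map′; ¬?; _×-dec_; _⊎-dec_)
open import Relation.Nullary.Negation using (¬_; contradiction)
import Relation.Unary as U

-- Vertex types are arbitrary finite types rather than Fin n, so that the
-- constructions below can be written with disjoint unions of vertex types.

record Graph : Set₁ where
  infix 4 _~_ _~?_
  field
    Vertex   : Set
    order    : ℕ
    enum     : Vertex ↔ Fin order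
    _~_      : Vertex → Vertex → Set
    _~?_     : Decidable _~_
    ~-sym    : Symmetric _~_
    ~-irrefl : Irreflexive _≡_ _~_

  index : Vertex → Fin order
  index = Inverse.to enum

  vertex : Fin order → Vertex
  vertex = Inverse.from enum

  index-vertex : ∀ i → index (vertex i) ≡ i
  index-vertex = Inverse.strictlyInverseˡ enum

  vertex-index : ∀ x → vertex (index x) ≡ x
  vertex-index = Inverse.strictlyInverseʳ enum

  _≟_ : DecidableEquality Vertex
  _≟_ = inj⇒≟ (↔⇒↣ enum)

record Edge (G : Graph) : Set where
  constructor edge
  open Graph G
  field
    {end₁ end₂} : Vertex
    adjacent    : end₁ ~ end₂

module _ (G : Graph) where
  open Graph G

  Connected : Set
  Connected = ∀ x y → Star _~_ x y

  degree : Vertex → ℕ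
  degree x = ∣ tabulate (λ i → does (x ~? vertex i)) ∣

  Leaf : Vertex → Set
  Leaf x = degree x ≡ 1

  Support : Vertex → Set
  Support x = ∃[ y ] (x ~ y × Leaf y)

  Hairy : Set
  Hairy = ∀ x → Leaf x ⊎ Support x

  Dominating : Subset order → Set
  Dominating S = ∀ x → index x ∈ S ⊎ ∃[ y ] (index y ∈ S × x ~ y)

  DominatingOfSize : ℕ → Set
  DominatingOfSize k = ∃[ S ] (Dominating S × ∣ S ∣ ≡ k)

least : ∀ {P : ℕ → Set} → U.Decidable P → ∃ P →
        ∃[ k ] (P k × (∀ j → P j → k ≤ j))
least P? (n , p) = search P? n p
  where
  search : ∀ {P : ℕ → Set} → U.Decidable P → ∀ n → P n →
           ∃[ k ] (P k × (∀ j → P j → k ≤ j))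
  search P? zero    p = zero , p , λ _ _ → z≤n
  search P? (suc n) p with P? 0
  ... | yes p₀ = zero , p₀ , λ _ _ → z≤n
  ... | no ¬p₀ with search (P? ∘ suc) n p
  ...   | k , pk , min = suc k , pk , λ where
            zero    q → contradiction q ¬p₀
            (suc j) q → s≤s (min j q)

module _ (G : Graph) where
  open Graph G

  dominating? : U.Decidable (Dominating G)
  dominating? S =
    map′ (λ f x → subst Dominated (vertex-index x) (f (index x)))
         (λ f i → f (vertex i))
         (all? (dominated? ∘ vertex))
    where
    Dominated : Vertex → Set
    Dominated x = index x ∈ S ⊎ ∃[ y ] (index y ∈ S × x ~ y)

    dominated? : U.Decidable Dominated
    dominated? x = (index x ∈? S) ⊎-dec
      map′ (λ (i , p) → vertex i , p)
           (λ (y , p) → index y ,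
              subst (λ z → index z ∈ S × x ~ z) (sym (vertex-index y)) p)
           (any? λ i → (index (vertex i) ∈? S) ×-dec (x ~? vertex i))

  γ-least : ∃[ k ] (DominatingOfSize G k × (∀ j → DominatingOfSize G j → k ≤ j))
  γ-least =
    least (λ k → anySubset? (λ S → dominating? S ×-dec (∣ S ∣ ℕ.≟ k)))
          (∣ ⊤ {order} ∣ , ⊤ , (λ _ → inj₁ ∈⊤) , refl)

  γ : ℕ
  γ = proj₁ γ-least

  γ-attained : DominatingOfSize G γ
  γ-attained = proj₁ (proj₂ γ-least)

  γ-minimal : ∀ S → Dominating G S → γ ≤ ∣ S ∣
  γ-minimal S d = proj₂ (proj₂ γ-least) ∣ S ∣ (S , d , refl)

deleteEdge : (G : Graph) → Edge G → Graph
deleteEdge G (edge {a} {b} _) = record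
  { Vertex   = Vertex
  ; order    = order
  ; enum     = enum
  ; _~_      = λ x y → x ~ y × ¬ IsEdge x y
  ; _~?_     = λ x y → (x ~? y) ×-dec ¬? (isEdge? x y)
  ; ~-sym    = λ (x~y , ne) → ~-sym x~y , ne ∘ isEdge-sym
  ; ~-irrefl = λ x≡y (x~y , _) → ~-irrefl x≡y x~y
  }
  where
  open Graph G

  IsEdge : Vertex → Vertex → Set
  IsEdge x y = (x ≡ a × y ≡ b) ⊎ (x ≡ b × y ≡ a)

  isEdge? : Decidable IsEdge
  isEdge? x y = ((x ≟ a) ×-dec (y ≟ b)) ⊎-dec ((x ≟ b) ×-dec (y ≟ a))

  isEdge-sym : Symmetric IsEdge
  isEdge-sym (inj₁ (p , q)) = inj₂ (q , p)
  isEdge-sym (inj₂ (p , q)) = inj₁ (q , p)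

subdivideEdge : (G : Graph) → Edge G → Graph
subdivideEdge G e@(edge {a} {b} _) = record
  { Vertex   = Vertex ⊎ Unit.⊤
  ; order    = order + 1
  ; enum     = ↔-sym +↔⊎ ↔-∘ (enum ⊎-↔ ↔-sym 1↔⊤)
  ; _~_      = _~′_
  ; _~?_     = _~′?_
  ; ~-sym    = λ {x} {y} → ~′-sym x y
  ; ~-irrefl = λ { {x} refl → ~′-irrefl x }
  }
  where
  open Graph G using (Vertex; order; enum; _≟_)
  open Graph (deleteEdge G e) using (_~_; _~?_; ~-sym; ~-irrefl)

  pattern w = inj₂ Unit.tt

  _~′_ : Vertex ⊎ Unit.⊤ → Vertex ⊎ Unit.⊤ → Set
  inj₁ x ~′ inj₁ y = x ~ y
  inj₁ x ~′ w      = x ≡ a ⊎ x ≡ b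
  w      ~′ inj₁ y = y ≡ a ⊎ y ≡ b
  w      ~′ w      = ⊥

  _~′?_ : Decidable _~′_
  inj₁ x ~′? inj₁ y = x ~? y
  inj₁ x ~′? w      = (x ≟ a) ⊎-dec (x ≟ b)
  w      ~′? inj₁ y = (y ≟ a) ⊎-dec (y ≟ b)
  w      ~′? w      = no λ ()

  ~′-sym : ∀ x y → x ~′ y → y ~′ x
  ~′-sym (inj₁ x) (inj₁ y) p = ~-sym p
  ~′-sym (inj₁ x) w        p = p
  ~′-sym w        (inj₁ y) p = p

  ~′-irrefl : ∀ x → ¬ (x ~′ x)
  ~′-irrefl (inj₁ x) p = ~-irrefl refl p

record IsSR (G : Graph) : Set where
  field
    connected    : Connected G
    order≥2      : 2 ≤ Graph.order G
    subRemovable : ∀ (e : Edge G) → γ (deleteEdge G e) ≡ γ (subdivideEdge G e)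

-- The path vertices are indexed from 0: path i stands for x_{i+1}.  For t = 0
-- the result is just the disjoint union of H₁ and H₂.

joinByPath : (t : ℕ) (H₁ H₂ : Graph) → Graph.Vertex H₁ → Graph.Vertex H₂ → Graph
joinByPath t H₁ H₂ u v = record
  { Vertex   = V
  ; order    = G₁.order + (G₂.order + t)
  ; enum     = ↔-sym +↔⊎ ↔-∘ (G₁.enum ⊎-↔ (↔-sym +↔⊎ ↔-∘ (G₂.enum ⊎-↔ ↔-id _)))
  ; _~_      = _~_
  ; _~?_     = _~?_
  ; ~-sym    = λ {x} {y} → ~-sym x y
  ; ~-irrefl = λ { {x} refl → ~-irrefl x }
  }
  where
  module G₁ = Graph H₁
  module G₂ = Graph H₂

  V : Set
  V = G₁.Vertex ⊎ (G₂.Vertex ⊎ Fin t)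

  pattern in₁ x  = inj₁ x
  pattern in₂ x  = inj₂ (inj₁ x)
  pattern path i = inj₂ (inj₂ i)

  _~_ : V → V → Set
  in₁ x  ~ in₁ y  = x G₁.~ y
  in₁ x  ~ in₂ y  = ⊥
  in₁ x  ~ path i = x ≡ u × toℕ i ≡ 0
  in₂ x  ~ in₁ y  = ⊥
  in₂ x  ~ in₂ y  = x G₂.~ y
  in₂ x  ~ path i = x ≡ v × suc (toℕ i) ≡ t
  path i ~ in₁ y  = y ≡ u × toℕ i ≡ 0
  path i ~ in₂ y  = y ≡ v × suc (toℕ i) ≡ t
  path i ~ path j = suc (toℕ i) ≡ toℕ j ⊎ suc (toℕ j) ≡ toℕ i

  _~?_ : Decidable _~_
  in₁ x  ~? in₁ y  = x G₁.~? y
  in₁ x  ~? in₂ y  = no λ ()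
  in₁ x  ~? path i = (x G₁.≟ u) ×-dec (toℕ i ℕ.≟ 0)
  in₂ x  ~? in₁ y  = no λ ()
  in₂ x  ~? in₂ y  = x G₂.~? y
  in₂ x  ~? path i = (x G₂.≟ v) ×-dec (suc (toℕ i) ℕ.≟ t)
  path i ~? in₁ y  = (y G₁.≟ u) ×-dec (toℕ i ℕ.≟ 0)
  path i ~? in₂ y  = (y G₂.≟ v) ×-dec (suc (toℕ i) ℕ.≟ t)
  path i ~? path j = (suc (toℕ i) ℕ.≟ toℕ j) ⊎-dec (suc (toℕ j) ℕ.≟ toℕ i)

  ~-sym : ∀ x y → x ~ y → y ~ x
  ~-sym (in₁ x)  (in₁ y)  p = G₁.~-sym p
  ~-sym (in₁ x)  (path i) p = p
  ~-sym (in₂ x)  (in₂ y)  p = G₂.~-sym p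
  ~-sym (in₂ x)  (path i) p = p
  ~-sym (path i) (in₁ y)  p = p
  ~-sym (path i) (in₂ y)  p = p
  ~-sym (path i) (path j) p = swap p

  ~-irrefl : ∀ x → ¬ (x ~ x)
  ~-irrefl (in₁ x)  p        = G₁.~-irrefl refl p
  ~-irrefl (in₂ x)  p        = G₂.~-irrefl refl p
  ~-irrefl (path i) (inj₁ p) = ℕ.1+n≢n p
  ~-irrefl (path i) (inj₂ p) = ℕ.1+n≢n p

{-# OPTIONS --safe #-}

-- If vertices p_i of G have pairwise disjoint closed neighbourhoods, every
-- dominating set contains at least one vertex of each neighbourhood, and this
-- survives deleting or subdividing an edge.  Every edge gets an equally large
-- family that dominates G - e and meets e, hence dominates G_e as well.  The
-- p_i are one leaf per support vertex together with the middle vertices of the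
-- consecutive triples of the path; the family consists of the support vertices
-- and one vertex per triple, chosen by the position of e relative to the triple.
-- Only for a pendant edge is a change needed: its leaf replaces the support
-- vertex if that has no other leaf, and is added on both sides otherwise.

module Submission where

open import Defs
open import Data.Empty using (⊥; ⊥-elim)
open import Data.Fin.Base using (Fin; toℕ; zero; suc; combine; inject₁; fromℕ; fromℕ<)
open import Data.Fin.Patterns using (0F; 1F; 2F)
open import Data.Fin.Properties
  using (+↔⊎; 1↔⊤; any?; combine-injectiveˡ; combine-surjective; inj⇒≟; suc-injective;
         toℕ-combine; toℕ-fromℕ; toℕ-fromℕ<; toℕ-inject₁; toℕ-injective; toℕ<n)
open import Data.Fin.Subset using (Subset; _∈_; _∪_; _-_; ⁅_⁆; ∣_∣; inside; outside)
  renaming (⊥ to ∅)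
open import Data.Fin.Subset.Properties
  using (∣⊥∣≡0; ∣⁅x⁆∣≡1; x∈⁅x⁆; x∈p∪q⁺; x∈p⇒∣p-x∣<∣p∣; x∈p∧x≢y⇒x∈p-y)
open import Data.Nat.Base using (ℕ; zero; suc; _+_; _*_; _≤_; _<_; z≤n; s≤s; _/_; _%_)
open import Data.Nat.Divisibility using (divides; m%n≡0⇒n∣m)
open import Data.Nat.DivMod using (m≡m%n+[m/n]*n; m%n<n)
import Data.Nat.Properties as ℕ
open import Data.Product.Base using (∃-syntax; _×_; _,_; proj₁; proj₂)
open import Data.Sum.Base as Sum using (_⊎_; inj₁; inj₂)
open import Data.Sum.Function.Propositional using (_⊎-↔_)
open import Data.Sum.Properties using (inj₁-injective; inj₂-injective)
import Data.Unit.Base as Unit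
open import Data.Vec.Base using ([]; _∷_; tabulate)
open import Data.Vec.Properties using (lookup∘tabulate; lookup⇒[]=)
open import Function.Base using (_∘_; id)
open import Function.Bundles using (_↔_; module Inverse)
open import Function.Construct.Composition using (_↔-∘_)
open import Function.Construct.Identity using (↔-id)
open import Function.Construct.Symmetry using (↔-sym)
open import Function.Definitions using (Injective)
open import Function.Properties.Inverse using (↔⇒↣)
open import Relation.Binary.Construct.Closure.ReflexiveTransitive
  using (Star; ε; _◅_; _◅◅_; gmap; reverse)
open import Relation.Binary.Definitions using (DecidableEquality; Tri; tri<; tri≈; tri>)
open import Relation.Binary.PropositionalEquality
  using (_≡_; _≢_; refl; sym; trans; cong; subst; subst₂)
open import Relation.Nullary.Decidable using (Dec; yes; no; map′; dec-true; _×-dec_; ¬?)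
open import Relation.Nullary.Negation using (¬_; contradiction)
import Relation.Unary as U

-- Counting in finite subsets.

∣p∪q∣≤∣p∣+∣q∣ : ∀ {n} (p q : Subset n) → ∣ p ∪ q ∣ ≤ ∣ p ∣ + ∣ q ∣
∣p∪q∣≤∣p∣+∣q∣ []            []            = z≤n
∣p∪q∣≤∣p∣+∣q∣ (outside ∷ p) (outside ∷ q) = ∣p∪q∣≤∣p∣+∣q∣ p q
∣p∪q∣≤∣p∣+∣q∣ (outside ∷ p) (inside  ∷ q) =
  ℕ.≤-trans (s≤s (∣p∪q∣≤∣p∣+∣q∣ p q)) (ℕ.≤-reflexive (sym (ℕ.+-suc ∣ p ∣ ∣ q ∣)))
∣p∪q∣≤∣p∣+∣q∣ (inside  ∷ p) (outside ∷ q) = s≤s (∣p∪q∣≤∣p∣+∣q∣ p q)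
∣p∪q∣≤∣p∣+∣q∣ (inside  ∷ p) (inside  ∷ q) =
  s≤s (ℕ.≤-trans (∣p∪q∣≤∣p∣+∣q∣ p q) (ℕ.+-monoʳ-≤ ∣ p ∣ (ℕ.n≤1+n ∣ q ∣)))

image : ∀ {m n} → (Fin n → Fin m) → Subset m
image {n = zero}  f = ∅
image {n = suc n} f = ⁅ f zero ⁆ ∪ image (f ∘ suc)

∈-image : ∀ {m n} (f : Fin n → Fin m) i → f i ∈ image f
∈-image f zero    = x∈p∪q⁺ (inj₁ (x∈⁅x⁆ (f zero)))
∈-image f (suc i) = x∈p∪q⁺ (inj₂ (∈-image (f ∘ suc) i))

∣image∣≤n : ∀ {m n} (f : Fin n → Fin m) → ∣ image f ∣ ≤ n
∣image∣≤n {m} {zero}  f = ℕ.≤-reflexive (∣⊥∣≡0 m)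
∣image∣≤n {m} {suc n} f = ℕ.≤-trans (∣p∪q∣≤∣p∣+∣q∣ ⁅ f zero ⁆ (image (f ∘ suc)))
  (ℕ.+-mono-≤ (ℕ.≤-reflexive (∣⁅x⁆∣≡1 (f zero))) (∣image∣≤n (f ∘ suc)))

injection⇒≤∣∣ : ∀ {m n} (S : Subset m) (f : Fin n → Fin m) → Injective _≡_ _≡_ f →
                (∀ i → f i ∈ S) → n ≤ ∣ S ∣
injection⇒≤∣∣ {n = zero}  S f inj f∈S = z≤n
injection⇒≤∣∣ {n = suc n} S f inj f∈S = ℕ.≤-trans
  (s≤s (injection⇒≤∣∣ (S - f zero) (f ∘ suc) (suc-injective ∘ inj)
    (λ i → x∈p∧x≢y⇒x∈p-y (f∈S (suc i)) λ eq → contradiction (inj eq) λ ())))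
  (x∈p⇒∣p-x∣<∣p∣ (f∈S zero))

-- Turns a decidable part of `Fin n` into an index type `Fin size`, so that the support vertices of
-- a hairy graph can index packings and families.
record Listing {n} (P : Fin n → Set) : Set where
  field
    {size}    : ℕ
    item      : Fin size → Fin n
    injective : Injective _≡_ _≡_ item
    sound     : ∀ i → P (item i)
    complete  : ∀ {x} → P x → ∃[ i ] item i ≡ x

listing : ∀ {n} {P : Fin n → Set} → U.Decidable P → Listing P
listing {zero}  P? = record
  { size = zero ; item = λ () ; injective = λ { {()} } ; sound = λ () ; complete = λ { {()} } }
listing {suc n} {P} P? with P? zero | listing (P? ∘ suc)
... | yes p | L = record
  { item      = item′
  ; injective = λ {i} {j} → injective′ i j
  ; sound     = λ { zero → p ; (suc i) → L.sound i }
  ; complete  = λ { {zero}  _ → zero , refl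
                  ; {suc x} q → let i , eq = L.complete q in suc i , cong suc eq }
  }
  where
  module L = Listing L
  item′ : Fin (suc L.size) → Fin (suc n)
  item′ zero    = zero
  item′ (suc i) = suc (L.item i)

  injective′ : ∀ i j → item′ i ≡ item′ j → i ≡ j
  injective′ zero    zero    eq = refl
  injective′ (suc i) (suc j) eq = cong suc (L.injective (suc-injective eq))
... | no ¬p | L = record
  { item      = suc ∘ L.item
  ; injective = L.injective ∘ suc-injective
  ; sound     = L.sound
  ; complete  = λ { {zero}  q → contradiction q ¬p
                  ; {suc x} q → let i , eq = L.complete q in i , cong suc eq }
  }
  where module L = Listing L

-- Bounds on the domination number from packings and dominating families.

module _ (G : Graph) where
  open Graph G

  index-injective : ∀ {x y} → index x ≡ index y → x ≡ y
  index-injective eq = trans (sym (vertex-index _)) (trans (cong vertex eq) (vertex-index _))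

  vertex-injective : ∀ {i j} → vertex i ≡ vertex j → i ≡ j
  vertex-injective eq = trans (sym (index-vertex _)) (trans (cong index eq) (index-vertex _))

  Near : Vertex → Vertex → Set
  Near x y = y ≡ x ⊎ x ~ y

  -- The closed neighbourhoods of the `p i` are pairwise disjoint. Taking `z` to be `p i` itself
  -- shows that `p` is injective.
  Packing : {I : Set} → (I → Vertex) → Set
  Packing p = ∀ {i j z} → Near (p i) z → Near (p j) z → i ≡ j

  DominatedBy : {I : Set} → (I → Vertex) → Set
  DominatedBy f = ∀ x → ∃[ i ] Near x (f i)

  anyVertex? : ∀ {P : Vertex → Set} → U.Decidable P → Dec (∃[ x ] P x)
  anyVertex? {P} P? = map′
    (λ (i , q) → vertex i , q)
    (λ (x , q) → index x , subst P (sym (vertex-index x)) q)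
    (any? (P? ∘ vertex))

  module _ {I : Set} {n : ℕ} (I↔Fin : I ↔ Fin n) where
    open Inverse I↔Fin using (to; from; strictlyInverseˡ; strictlyInverseʳ)

    dominatedBy⇒γ≤ : ∀ {f : I → Vertex} → DominatedBy f → γ G ≤ n
    dominatedBy⇒γ≤ {f} dom =
      ℕ.≤-trans (γ-minimal G (image g) dominating) (∣image∣≤n g)
      where
      g : Fin n → Fin order
      g = index ∘ f ∘ from

      in-image : ∀ i → index (f i) ∈ image g
      in-image i = subst (λ j → index (f j) ∈ image g) (strictlyInverseʳ i) (∈-image g (to i))

      dominating : Dominating G (image g)
      dominating x with dom x
      ... | i , inj₁ refl  = inj₁ (in-image i)
      ... | i , inj₂ x~fi  = inj₂ (f i , in-image i , x~fi)

    -- A minimum dominating set has an element in each closed neighbourhood of a packed vertex, and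
    -- disjointness makes these elements distinct.
    packing⇒≤γ : ∀ {p : I → Vertex} → Packing p → n ≤ γ G
    packing⇒≤γ {p} packing with γ-attained G
    ... | S , dominating , ∣S∣≡γ = subst (n ≤_) ∣S∣≡γ
      (injection⇒≤∣∣ S (index ∘ dominator ∘ p ∘ from) injective (dominator∈S ∘ p ∘ from))
      where
      dominator : Vertex → Vertex
      dominator x = Sum.[ (λ _ → x) , proj₁ ] (dominating x)

      dominator∈S : ∀ x → index (dominator x) ∈ S
      dominator∈S x with dominating x
      ... | inj₁ x∈S         = x∈S
      ... | inj₂ (_ , y∈S , _) = y∈S

      near : ∀ x → Near x (dominator x)
      near x with dominating x
      ... | inj₁ _             = inj₁ refl
      ... | inj₂ (_ , _ , x~y) = inj₂ x~y

      injective : Injective _≡_ _≡_ (index ∘ dominator ∘ p ∘ from)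
      injective {i} {j} eq =
        trans (sym (strictlyInverseˡ i)) (trans (cong to from-eq) (strictlyInverseˡ j))
        where
        same : dominator (p (from i)) ≡ dominator (p (from j))
        same = index-injective eq

        from-eq : from i ≡ from j
        from-eq = packing (near _) (subst (Near (p (from j))) (sym same) (near _))

  SameEdge : (a b x y : Vertex) → Set
  SameEdge a b x y = (x ≡ a × y ≡ b) ⊎ (x ≡ b × y ≡ a)

  sameEdge-sym : ∀ {a b x y} → SameEdge a b x y → SameEdge a b y x
  sameEdge-sym (inj₁ (p , q)) = inj₂ (q , p)
  sameEdge-sym (inj₂ (p , q)) = inj₁ (q , p)

  -- Unfolds to `Near` of the graph with the edge `ab` deleted, so that `certified` can use the
  -- fields of a certificate there as they stand.
  NearAvoiding : (a b x y : Vertex) → Set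
  NearAvoiding a b x y = y ≡ x ⊎ (x ~ y × ¬ SameEdge a b x y)

  near-swap : ∀ {a b x y} → NearAvoiding a b x y → NearAvoiding b a x y
  near-swap = Sum.map₂ λ (x~y , ¬same) → x~y , ¬same ∘ Sum.swap

  forget : ∀ {a b x y} → NearAvoiding a b x y → Near x y
  forget = Sum.map₂ proj₁

  -- Along the edge `ab`, the vertex `b` lies in the closed neighbourhoods of both `p i` and `p j`.
  packing⇒apart : ∀ {I : Set} {p : I → Vertex} {a b i j} → a ~ b → Packing p →
                  p i ≡ a → p j ≡ b → i ≡ j
  packing⇒apart a~b packing refl refl = packing (inj₂ a~b) (inj₁ refl)

  Listed : {I : Set} → (I → Vertex) → Vertex → Set
  Listed f x = ∃[ i ] f i ≡ x

  listed⇒near : ∀ {I : Set} {f : I → Vertex} {a b x y} → Listed f y →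
                x ~ y → ¬ SameEdge a b x y → ∃[ i ] NearAvoiding a b x (f i)
  listed⇒near (i , refl) x~y ¬same = i , inj₂ (x~y , ¬same)

  -- Determines γ(G - ab) = γ(G_ab) = size: the new vertex of G_ab lies in at most
  -- one of the neighbourhoods of packed vertices, and it is dominated by the
  -- family because that contains a or b.
  record Certificate (a b : Vertex) : Set₁ where
    field
      {Index}    : Set
      {size}     : ℕ
      enumerated : Index ↔ Fin size
      packed     : Index → Vertex
      packing    : ∀ {i j z} → NearAvoiding a b (packed i) z → NearAvoiding a b (packed j) z →
                   i ≡ j
      apart      : ∀ {i j} → packed i ≡ a → packed j ≡ b → i ≡ j
      family     : Index → Vertex
      dominates  : ∀ x → ∃[ i ] NearAvoiding a b x (family i)
      touches    : ∃[ i ] (family i ≡ a ⊎ family i ≡ b)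

  certificate-swap : ∀ {a b} → Certificate a b → Certificate b a
  certificate-swap c = record
    { enumerated = enumerated
    ; packed     = packed
    ; packing    = λ n₁ n₂ → packing (near-swap n₁) (near-swap n₂)
    ; apart      = λ pi≡b pj≡a → sym (apart pj≡a pi≡b)
    ; family     = family
    ; dominates  = λ x → let i , near = dominates x in i , near-swap near
    ; touches    = let i , eq = touches in i , Sum.swap eq
    }
    where open Certificate c

certified : ∀ (G : Graph) {a b} (a~b : Graph._~_ G a b) → Certificate G a b →
            γ (deleteEdge G (edge a~b)) ≡ γ (subdivideEdge G (edge a~b))
certified G {a} {b} a~b c = trans
  (ℕ.≤-antisym (dominatedBy⇒γ≤ G⁻ enumerated dominates) (packing⇒≤γ G⁻ enumerated packing))
  (ℕ.≤-antisym (packing⇒≤γ G⁺ enumerated packing⁺) (dominatedBy⇒γ≤ G⁺ enumerated dominates⁺))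
  where
  open Certificate c
  G⁻ G⁺ : Graph
  G⁻ = deleteEdge G (edge a~b)
  G⁺ = subdivideEdge G (edge a~b)

  dominates⁺ : DominatedBy G⁺ (inj₁ ∘ family)
  dominates⁺ (inj₁ x)       = let i , near = dominates x in i , Sum.map₁ (cong inj₁) near
  dominates⁺ (inj₂ Unit.tt) = let i , eq = touches in i , inj₂ eq

  near⁺⇒near : ∀ {x z} → Near G⁺ (inj₁ x) (inj₁ z) → Near G⁻ x z
  near⁺⇒near (inj₁ refl) = inj₁ refl
  near⁺⇒near (inj₂ x~z)  = inj₂ x~z

  packing⁺ : Packing G⁺ (inj₁ ∘ packed)
  packing⁺ {z = inj₁ z} near₁ near₂ = packing (near⁺⇒near near₁) (near⁺⇒near near₂)
  -- The new vertex is near an old one only if that is `a` or `b`. The same endpoint twice means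
  -- equal packed vertices; different endpoints are the case of `apart`.
  packing⁺ {z = inj₂ Unit.tt} (inj₂ (inj₁ pi≡a)) (inj₂ (inj₁ pj≡a)) =
    packing (inj₁ refl) (inj₁ (trans pi≡a (sym pj≡a)))
  packing⁺ {z = inj₂ Unit.tt} (inj₂ (inj₁ pi≡a)) (inj₂ (inj₂ pj≡b)) = apart pi≡a pj≡b
  packing⁺ {z = inj₂ Unit.tt} (inj₂ (inj₂ pi≡b)) (inj₂ (inj₁ pj≡a)) = sym (apart pj≡a pi≡b)
  packing⁺ {z = inj₂ Unit.tt} (inj₂ (inj₂ pi≡b)) (inj₂ (inj₂ pj≡b)) =
    packing (inj₁ refl) (inj₁ (trans pi≡b (sym pj≡b)))

-- Packing and dominating the path when one of its edges is cut.

Consecutive : ∀ {t} → Fin t → Fin t → Set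
Consecutive i j = suc (toℕ i) ≡ toℕ j ⊎ suc (toℕ j) ≡ toℕ i

-- How the j-th of t path vertices is dominated when the edge joining
-- positions m - 1 and m is not available; position -1 stands for u and
-- position t for v.
data Covered {t k} (m : ℕ) (centre : Fin k → Fin t) (j : Fin t) : Set where
  itself : ∀ q → centre q ≡ j → Covered m centre j
  left   : ∀ q → suc (toℕ (centre q)) ≡ toℕ j → toℕ j ≢ m → Covered m centre j
  right  : ∀ q → suc (toℕ j) ≡ toℕ (centre q) → toℕ (centre q) ≢ m → Covered m centre j
  start  : toℕ j ≡ 0 → m ≢ 0 → Covered m centre j
  end    : suc (toℕ j) ≡ t → m ≢ t → Covered m centre j

-- In the first two alternatives of `touches` the cut edge ends in `u` or `v`, which the standard
-- family contains anyway; otherwise a centre has to be an end of the edge.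
record Cut (t k m : ℕ) : Set where
  field
    centre  : Fin k → Fin t
    covered : ∀ j → Covered m centre j
    touches : m ≡ 0 ⊎ m ≡ t ⊎ ∃[ q ] (toℕ (centre q) ≡ m ⊎ suc (toℕ (centre q)) ≡ m)

-- What the length of the path has to provide: `k` packed vertices whose neighbourhoods stay on the
-- path, and equally many centres for every cut. The two conditions on the `middle` positions keep
-- them away from `u` and `v`. That one `k` serves both purposes is what the assumption on `t`
-- secures.
record Blocks (t k : ℕ) : Set where
  field
    middle         : Fin k → Fin t
    middle-start   : ∀ q → toℕ (middle q) ≢ 0
    middle-end     : ∀ q → suc (toℕ (middle q)) ≢ t
    middle-packing : ∀ {q q′ j} → j ≡ middle q ⊎ Consecutive (middle q) j →
                     j ≡ middle q′ ⊎ Consecutive (middle q′) j → q ≡ q′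
    cut            : ∀ {m} → m ≤ t → Cut t k m

-- The single path vertex is adjacent to both `u` and `v`, and a cut takes away only one of these
-- edges, so no centres are required.
trivialBlocks : Blocks 1 0
trivialBlocks = record
  { middle         = λ ()
  ; middle-start   = λ ()
  ; middle-end     = λ ()
  ; middle-packing = λ { {()} }
  ; cut            = λ where
      z≤n       → record
        { centre = λ () ; covered = λ { zero → end refl λ () } ; touches = inj₁ refl }
      (s≤s z≤n) → record
        { centre = λ () ; covered = λ { zero → start refl λ () } ; touches = inj₂ (inj₁ refl) }
  }

module _ {k : ℕ} where

  -- The offset stands first so that for a concrete `r` the right side computes to successors of
  -- `toℕ q * 3`.
  toℕ-position : ∀ (q : Fin k) (r : Fin 3) → toℕ (combine q r) ≡ toℕ r + toℕ q * 3
  toℕ-position q r = trans (toℕ-combine q r)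
    (trans (ℕ.+-comm (3 * toℕ q) (toℕ r)) (cong (toℕ r +_) (ℕ.*-comm 3 (toℕ q))))

  position-unique : ∀ {j : Fin (k * 3)} q r → toℕ j ≡ toℕ r + toℕ q * 3 → j ≡ combine q r
  position-unique q r eq = toℕ-injective (trans eq (sym (toℕ-position q r)))

  -- The neighbours of a middle vertex are the other two vertices of its triple, so different
  -- triples give disjoint neighbourhoods.
  near-middle : ∀ q {j : Fin (k * 3)} → j ≡ combine q 1F ⊎ Consecutive (combine q 1F) j →
                ∃[ r ] j ≡ combine q r
  near-middle q (inj₁ eq)         = 1F , eq
  near-middle q (inj₂ (inj₁ eq))  =
    2F , position-unique q 2F (trans (sym eq) (cong suc (toℕ-position q 1F)))
  near-middle q (inj₂ (inj₂ eq))  =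
    0F , position-unique q 0F (ℕ.suc-injective (trans eq (toℕ-position q 1F)))

  block<k : ∀ (q : Fin k) → 3 + toℕ q * 3 ≤ k * 3
  block<k q = ℕ.*-monoˡ-≤ 3 (toℕ<n q)

predecessor : ∀ {k} (q : Fin k) → toℕ q ≡ 0 ⊎ ∃[ q′ ] suc (toℕ {k} q′) ≡ toℕ q
predecessor zero    = inj₁ refl
predecessor (suc q) = inj₂ (inject₁ q , cong suc (toℕ-inject₁ q))

successor : ∀ {k} (q : Fin k) → suc (toℕ q) ≡ k ⊎ ∃[ q′ ] toℕ {k} q′ ≡ suc (toℕ q)
successor q with ℕ.m≤n⇒m<n∨m≡n (toℕ<n q)
... | inj₁ q+1<k = inj₂ (fromℕ< q+1<k , toℕ-fromℕ< q+1<k)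
... | inj₂ q+1≡k = inj₁ q+1≡k

-- With a = ⌊m / 3⌋ the cut lies in block a: the blocks before it take their
-- last vertex as centre, the blocks after it their first.
module _ {k m : ℕ} (m≤3k : m ≤ k * 3) where
  private
    a : ℕ
    a = m / 3

    m≡ : m ≡ m % 3 + a * 3
    m≡ = m≡m%n+[m/n]*n m 3

    3a≤m : a * 3 ≤ m
    3a≤m = subst (a * 3 ≤_) (sym m≡) (ℕ.m≤n+m (a * 3) (m % 3))

    m<3+3a : m < 3 + a * 3
    m<3+3a = subst (_< 3 + a * 3) (sym m≡) (ℕ.+-monoˡ-< (a * 3) (m%n<n m 3))

    before : ∀ {q} → q < a → 3 + q * 3 ≤ m
    before q<a = ℕ.≤-trans (ℕ.*-monoˡ-≤ 3 q<a) 3a≤m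

    after : ∀ {q} → a < q → m < q * 3
    after a<q = ℕ.<-≤-trans m<3+3a (ℕ.*-monoˡ-≤ 3 a<q)

    offset : ∀ {b} → Tri (b < a) (b ≡ a) (a < b) → Fin 3
    offset (tri< _ _ _) = 2F
    offset (tri≈ _ _ _) = 1F
    offset (tri> _ _ _) = 0F

    centre : Fin k → Fin (k * 3)
    centre q = combine q (offset (ℕ.<-cmp (toℕ q) a))

    centre-before : ∀ {q} → toℕ q < a → toℕ (centre q) ≡ 2 + toℕ q * 3
    centre-before {q} q<a with ℕ.<-cmp (toℕ q) a
    ... | tri< _ _ _   = toℕ-position q 2F
    ... | tri≈ ≮ _ _   = contradiction q<a ≮
    ... | tri> ≮ _ _   = contradiction q<a ≮

    centre-at : ∀ {q} → toℕ q ≡ a → toℕ (centre q) ≡ 1 + toℕ q * 3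
    centre-at {q} q≡a with ℕ.<-cmp (toℕ q) a
    ... | tri< _ ≢ _   = contradiction q≡a ≢
    ... | tri≈ _ _ _   = toℕ-position q 1F
    ... | tri> _ ≢ _   = contradiction q≡a ≢

    centre-after : ∀ {q} → a < toℕ q → toℕ (centre q) ≡ toℕ q * 3
    centre-after {q} a<q with ℕ.<-cmp (toℕ q) a
    ... | tri< _ _ ≯   = contradiction a<q ≯
    ... | tri≈ _ _ ≯   = contradiction a<q ≯
    ... | tri> _ _ _   = toℕ-position q 0F

    -- The preceding block lies before block `a`, so its centre is its last vertex, right next to
    -- this one; the very first block relies on `u`. Either way the edge used is number `toℕ q * 3`.
    first-of-block : ∀ q → toℕ q ≤ a → toℕ q * 3 ≢ m → Covered m centre (combine q 0F)
    first-of-block q q≤a 3q≢m with predecessor q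
    ... | inj₁ q≡0 = start (trans (toℕ-position q 0F) 3q≡0) (3q≢m ∘ trans 3q≡0 ∘ sym)
      where
      3q≡0 : toℕ q * 3 ≡ 0
      3q≡0 = cong (_* 3) q≡0
    ... | inj₂ (q′ , eq) = left q′
      (trans (cong suc (centre-before (subst (_≤ a) (sym eq) q≤a)))
        (trans (cong (_* 3) eq) (sym (toℕ-position q 0F))))
      (3q≢m ∘ trans (sym (toℕ-position q 0F)))

    -- Mirror image: the next block has its first vertex as centre, the final block relies on `v`,
    -- and the edge used is number `3 + toℕ q * 3`.
    last-of-block : ∀ q → a ≤ toℕ q → 3 + toℕ q * 3 ≢ m → Covered m centre (combine q 2F)
    last-of-block q a≤q 3+3q≢m with successor q
    ... | inj₁ q+1≡k = end
      (trans (cong suc (toℕ-position q 2F)) 3+3q≡3k) (3+3q≢m ∘ trans 3+3q≡3k ∘ sym)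
      where
      3+3q≡3k : 3 + toℕ q * 3 ≡ k * 3
      3+3q≡3k = cong (_* 3) q+1≡k
    ... | inj₂ (q′ , eq) = right q′
      (trans (cong suc (toℕ-position q 2F)) (sym centre≡)) (3+3q≢m ∘ trans (sym centre≡))
      where
      centre≡ : toℕ (centre q′) ≡ 3 + toℕ q * 3
      centre≡ = trans (centre-after (subst (a <_) (sym eq) (s≤s a≤q))) (cong (_* 3) eq)

    covered : ∀ (q : Fin k) (r : Fin 3) → Covered m centre (combine q r)
    covered q r with ℕ.<-cmp (toℕ q) a
    covered q 0F | tri< q<a _ _ = first-of-block q (ℕ.<⇒≤ q<a)
      (ℕ.<⇒≢ (ℕ.≤-trans (ℕ.m<n+m (toℕ q * 3) (s≤s z≤n)) (before q<a)))
    covered q 1F | tri< q<a _ _ = right q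
      (trans (cong suc (toℕ-position q 1F)) (sym (centre-before q<a)))
      (subst (_≢ m) (sym (centre-before q<a)) (ℕ.<⇒≢ (before q<a)))
    covered q 2F | tri< q<a _ _ = itself q (position-unique q 2F (centre-before q<a))
    -- Block `a` has its middle vertex as centre. If the edge from there to the first vertex is the
    -- one cut, the edge on the other side of the first vertex is intact and takes over.
    covered q 0F | tri≈ _ q≡a _ with 1 + toℕ q * 3 ℕ.≟ m
    ... | yes refl = first-of-block q (ℕ.≤-reflexive q≡a) (ℕ.1+n≢n ∘ sym)
    ... | no 3q+1≢m = right q
      (trans (cong suc (toℕ-position q 0F)) (sym (centre-at q≡a)))
      (subst (_≢ m) (sym (centre-at q≡a)) 3q+1≢m)
    covered q 1F | tri≈ _ q≡a _ = itself q (position-unique q 1F (centre-at q≡a))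
    covered q 2F | tri≈ _ q≡a _ with 2 + toℕ q * 3 ℕ.≟ m
    ... | yes refl = last-of-block q (ℕ.≤-reflexive (sym q≡a)) ℕ.1+n≢n
    ... | no 3q+2≢m = left q
      (trans (cong suc (centre-at q≡a)) (sym (toℕ-position q 2F)))
      (subst (_≢ m) (sym (toℕ-position q 2F)) 3q+2≢m)
    covered q 0F | tri> _ _ a<q = itself q (position-unique q 0F (centre-after a<q))
    covered q 1F | tri> _ _ a<q = left q
      (trans (cong suc (centre-after a<q)) (sym (toℕ-position q 1F)))
      (subst (_≢ m) (sym (toℕ-position q 1F)) (ℕ.>⇒≢ (ℕ.m<n⇒m<1+n (after a<q))))
    covered q 2F | tri> _ _ a<q = last-of-block q (ℕ.<⇒≤ a<q)
      (ℕ.>⇒≢ (ℕ.<-≤-trans (after a<q) (ℕ.m≤n+m (toℕ q * 3) 3)))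

    -- Edge `k * 3` ends in `v` and belongs to no block. For smaller `m` the remainder modulo 3
    -- decides: at 0 the edge is the one at `u` or starts at the last vertex of block `a - 1`, its
    -- centre; at 1 and 2 it is an edge at the middle of block `a`.
    touches : m ≡ 0 ⊎ m ≡ k * 3 ⊎ ∃[ q ] (toℕ (centre q) ≡ m ⊎ suc (toℕ (centre q)) ≡ m)
    touches with ℕ.m≤n⇒m<n∨m≡n m≤3k
    ... | inj₂ m≡3k = inj₂ (inj₁ m≡3k)
    ... | inj₁ m<3k = cases (m % 3) m≡ (m%n<n m 3)
      where
      a<k : a < k
      a<k = ℕ.*-cancelʳ-< 3 a k (ℕ.≤-<-trans 3a≤m m<3k)

      q : Fin k
      q = fromℕ< a<k

      q≡a : toℕ q ≡ a
      q≡a = toℕ-fromℕ< a<k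

      centre-q : toℕ (centre q) ≡ 1 + a * 3
      centre-q = trans (centre-at q≡a) (cong (λ b → 1 + b * 3) q≡a)

      cases : ∀ r → m ≡ r + a * 3 → r < 3 →
              m ≡ 0 ⊎ m ≡ k * 3 ⊎ ∃[ q ] (toℕ (centre q) ≡ m ⊎ suc (toℕ (centre q)) ≡ m)
      cases 0 m≡3a _ with predecessor q
      ... | inj₁ q≡0 = inj₁ (trans m≡3a (cong (_* 3) (trans (sym q≡a) q≡0)))
      ... | inj₂ (q′ , eq) = inj₂ (inj₂ (q′ , inj₂ (trans
        (cong suc (centre-before (ℕ.≤-reflexive (trans eq q≡a))))
        (trans (cong (_* 3) (trans eq q≡a)) (sym m≡3a)))))
      cases 1 m≡3a+1 _ = inj₂ (inj₂ (q , inj₁ (trans centre-q (sym m≡3a+1))))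
      cases 2 m≡3a+2 _ = inj₂ (inj₂ (q , inj₂ (trans (cong suc centre-q) (sym m≡3a+2))))
      cases (suc (suc (suc _))) _ (s≤s (s≤s (s≤s ())))

  blockCut : Cut (k * 3) k m
  blockCut = record
    { centre  = centre
    ; covered = λ j → let q , r , eq = combine-surjective {k} {3} j in
                      subst (Covered m centre) eq (covered q r)
    ; touches = touches
    }

blocksOfThree : ∀ k → Blocks (k * 3) k
blocksOfThree k = record
  { middle         = λ q → combine q 1F
  ; middle-start   = λ q eq → contradiction (trans (sym (toℕ-position q 1F)) eq) λ ()
  ; middle-end     = λ q eq → ℕ.<⇒≢ (block<k q) (trans (sym (cong suc (toℕ-position q 1F))) eq)
  ; middle-packing = λ {q} {q′} near near′ →
      let r , eq = near-middle q near ; r′ , eq′ = near-middle q′ near′ in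
      combine-injectiveˡ q r q′ r′ (trans (sym eq) eq′)
  ; cut            = blockCut
  }

-- The join seen through hubs, tips and path vertices.

infixr 1 _⊎-enum_
_⊎-enum_ : ∀ {A B : Set} {m n} → A ↔ Fin m → B ↔ Fin n → (A ⊎ B) ↔ Fin (m + n)
A↔ ⊎-enum B↔ = ↔-sym +↔⊎ ↔-∘ (A↔ ⊎-↔ B↔)

-- `Tip` is a relation and not a function of the hub because a support vertex may have several
-- leaves.
data Kind {V H P : Set} (hub : H → V) (Tip : V → H → Set) (path : P → V) : V → Set where
  isHub  : ∀ i → Kind hub Tip path (hub i)
  isTip  : ∀ {x i} → Tip x i → Kind hub Tip path x
  isPath : ∀ j → Kind hub Tip path (path j)

-- The graph joinByPath t H₁ H₂ u v without the distinction between H₁ and H₂: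
-- hubs are their support vertices, tips their leaves.
record HairyJoin (G : Graph) (t : ℕ) : Set₁ where
  open Graph G
  field
    Hub              : Set
    {hubCount}       : ℕ
    hubs             : Hub ↔ Fin hubCount
    hub              : Hub → Vertex
    hub-injective    : ∀ {i j} → hub i ≡ hub j → i ≡ j
    hub-neighbour    : ∀ i → ∃[ j ] hub i ~ hub j
    Tip              : Vertex → Hub → Set
    Tip?             : ∀ i → U.Decidable (λ x → Tip x i)
    tip              : Hub → Vertex
    tip-Tip          : ∀ i → Tip (tip i) i
    Tip⇒~            : ∀ {x i} → Tip x i → x ~ hub i
    Tip-unique       : ∀ {x i z} → Tip x i → x ~ z → z ≡ hub i
    hub-not-Tip      : ∀ {i j} → ¬ Tip (hub j) i
    path             : Fin t → Vertex
    path-injective   : ∀ {i j} → path i ≡ path j → i ≡ j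
    path-not-Tip     : ∀ {i j} → ¬ Tip (path j) i
    path≢hub         : ∀ {i j} → path j ≢ hub i
    first last       : Hub
    first≢last       : first ≢ last
    path~path        : ∀ {i j} → Consecutive i j → path i ~ path j
    path~first       : ∀ {j} → toℕ j ≡ 0 → path j ~ hub first
    path~last        : ∀ {j} → suc (toℕ j) ≡ t → path j ~ hub last
    path~path⁻       : ∀ {i j} → path i ~ path j → Consecutive i j
    path~hub⁻        : ∀ {i j} → path j ~ hub i →
                       (i ≡ first × toℕ j ≡ 0) ⊎ (i ≡ last × suc (toℕ j) ≡ t)
    kind             : ∀ x → Kind hub Tip path x

module _ {G : Graph} {t k : ℕ} (J : HairyJoin G t) (B : Blocks t k) where
  open Graph G
  open HairyJoin J
  open Blocks B

  private
    _≟ʰ_ : DecidableEquality Hub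
    _≟ʰ_ = inj⇒≟ (↔⇒↣ hubs)

    Piece : Set
    Piece = Hub ⊎ Fin k

    pieces : Piece ↔ Fin (hubCount + k)
    pieces = hubs ⊎-enum ↔-id _

    Tip-hub-unique : ∀ {x i j} → Tip x i → Tip x j → i ≡ j
    Tip-hub-unique p q = hub-injective (Tip-unique q (Tip⇒~ p))

  -- Contains the closed neighbourhood of the witness of a piece, whichever tip is chosen for a hub.
  -- Disjointness of the regions thus yields the packing for every choice of tips.
  Region : Vertex → Piece → Set
  Region z (inj₁ i) = Tip z i ⊎ z ≡ hub i
  Region z (inj₂ q) = ∃[ j ] (z ≡ path j × (j ≡ middle q ⊎ Consecutive (middle q) j))

  region-unique : ∀ {z} c d → Region z c → Region z d → c ≡ d
  region-unique (inj₁ i) (inj₁ j) (inj₁ p)    (inj₁ q)    = cong inj₁ (Tip-hub-unique p q)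
  region-unique (inj₁ i) (inj₁ j) (inj₁ p)    (inj₂ refl) = contradiction p hub-not-Tip
  region-unique (inj₁ i) (inj₁ j) (inj₂ refl) (inj₁ q)    = contradiction q hub-not-Tip
  region-unique (inj₁ i) (inj₁ j) (inj₂ refl) (inj₂ eq)   = cong inj₁ (hub-injective eq)
  region-unique (inj₁ i) (inj₂ q) (inj₁ p)    (_ , refl , _) = contradiction p path-not-Tip
  region-unique (inj₁ i) (inj₂ q) (inj₂ eq)   (_ , refl , _) = contradiction eq path≢hub
  region-unique (inj₂ q) (inj₁ i) (_ , refl , _) (inj₁ p)  = contradiction p path-not-Tip
  region-unique (inj₂ q) (inj₁ i) (_ , refl , _) (inj₂ eq) = contradiction eq path≢hub
  region-unique (inj₂ q) (inj₂ r) (_ , refl , near) (_ , eq , near′)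
    with refl ← path-injective eq = cong inj₂ (middle-packing near near′)

  module _ {tip : Hub → Vertex} (tip-Tip : ∀ i → Tip (tip i) i) where

    -- The choice of tips is a parameter since `doubleTip` has to avoid the leaf of the deleted
    -- edge.
    witness : Piece → Vertex
    witness = Sum.[ tip , path ∘ middle ]

    near-witness : ∀ c {z} → Near G (witness c) z → Region z c
    near-witness (inj₁ i) (inj₁ refl)  = inj₁ (tip-Tip i)
    near-witness (inj₁ i) (inj₂ tip~z) = inj₂ (Tip-unique (tip-Tip i) tip~z)
    near-witness (inj₂ q) (inj₁ refl)  = middle q , refl , inj₁ refl
    near-witness (inj₂ q) {z} (inj₂ mid~z) with kind z
    ... | isPath j = j , refl , inj₂ (path~path⁻ mid~z)
    ... | isTip p  = contradiction (Tip-unique p (~-sym mid~z)) path≢hub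
    ... | isHub i with path~hub⁻ mid~z
    ...   | inj₁ (_ , eq) = contradiction eq (middle-start q)
    ...   | inj₂ (_ , eq) = contradiction eq (middle-end q)

    witness-packing : Packing G witness
    witness-packing {c} {d} near near′ =
      region-unique c d (near-witness c near) (near-witness d near′)

    witness≢hub : ∀ c {i} → witness c ≢ hub i
    witness≢hub (inj₁ i) eq = hub-not-Tip (subst (λ x → Tip x i) eq (tip-Tip i))
    witness≢hub (inj₂ q) eq = path≢hub eq

  -- Says that `ab` is at most the edge numbered `m` on the way from `u` to `v`. If `ab` is not on
  -- this way, `m` can be chosen freely.
  record Avoids (a b : Vertex) (m : ℕ) : Set where
    field
      within  : ∀ {i j} → suc (toℕ i) ≡ toℕ j → toℕ j ≢ m → ¬ SameEdge G a b (path i) (path j)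
      atStart : ∀ {j} → toℕ j ≡ 0 → m ≢ 0 → ¬ SameEdge G a b (path j) (hub first)
      atEnd   : ∀ {j} → suc (toℕ j) ≡ t → m ≢ t → ¬ SameEdge G a b (path j) (hub last)

  -- A cut at 0 never relies on `u` and one at `t` never on `v`, so each of these hubs is demanded
  -- only for other values of `m`. This lets `singleTip` drop a hub from the family.
  path-dominated :
    ∀ {I : Set} {f : I → Vertex} {a b m} (c : Cut t k m) → Avoids a b m →
    (∀ q → Listed G f (path (Cut.centre c q))) →
    (m ≢ 0 → Listed G f (hub first)) → (m ≢ t → Listed G f (hub last)) →
    ∀ j → ∃[ i ] NearAvoiding G a b (path j) (f i)
  path-dominated c avoids centres first∈f last∈f j with Cut.covered c j
  ... | itself q refl   = let i , eq = centres q in i , inj₁ eq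
  ... | left q cons j≢m = listed⇒near G (centres q)
    (path~path (inj₂ cons)) (Avoids.within avoids cons j≢m ∘ sameEdge-sym G)
  ... | right q cons c≢m = listed⇒near G (centres q)
    (path~path (inj₁ cons)) (Avoids.within avoids cons c≢m)
  ... | start j≡0 m≢0 = listed⇒near G (first∈f m≢0) (path~first j≡0) (Avoids.atStart avoids j≡0 m≢0)
  ... | end j+1≡t m≢t = listed⇒near G (last∈f m≢t) (path~last j+1≡t) (Avoids.atEnd avoids j+1≡t m≢t)

  module _ {m : ℕ} (c : Cut t k m) where
    open Cut c

    standard : Piece → Vertex
    standard = Sum.[ hub , path ∘ centre ]

    -- Serves every edge that is not pendant: all leaves keep the edge to their hub, and the cut
    -- takes care of the path.
    standardCertificate :
      ∀ {a b} → a ~ b → Avoids a b m →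
      (∀ {x i} → Tip x i → ¬ SameEdge G a b x (hub i)) →
      ∃[ i ] (standard i ≡ a ⊎ standard i ≡ b) →
      Certificate G a b
    standardCertificate {a} {b} a~b avoids notTip hits = record
      { enumerated = pieces
      ; packed     = witness tip-Tip
      ; packing    = λ near near′ → witness-packing tip-Tip (forget G near) (forget G near′)
      ; apart      = packing⇒apart G a~b (witness-packing tip-Tip)
      ; family     = standard
      ; dominates  = dominates
      ; touches    = hits
      }
      where
      dominates : ∀ x → ∃[ i ] NearAvoiding G a b x (standard i)
      dominates x with kind x
      ... | isHub i         = inj₁ i , inj₁ refl
      ... | isTip {i = i} p = inj₁ i , inj₂ (Tip⇒~ p , notTip p)
      ... | isPath j        = path-dominated c avoids (λ q → inj₂ q , refl)
                                (λ _ → inj₁ first , refl) (λ _ → inj₁ last , refl) j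

  -- Certificates for each type of edge.

  avoids-hub-hub : ∀ {i j m} → Avoids (hub i) (hub j) m
  avoids-hub-hub = record
    { within  = λ _ _ → λ { (inj₁ (eq , _)) → path≢hub eq ; (inj₂ (eq , _)) → path≢hub eq }
    ; atStart = λ _ _ → λ { (inj₁ (eq , _)) → path≢hub eq ; (inj₂ (eq , _)) → path≢hub eq }
    ; atEnd   = λ _ _ → λ { (inj₁ (eq , _)) → path≢hub eq ; (inj₂ (eq , _)) → path≢hub eq }
    }

  Tip≢path : ∀ {x i j} → Tip x i → path j ≢ x
  Tip≢path p refl = path-not-Tip p

  Tip≢hub : ∀ {x i j} → Tip x i → hub j ≢ x
  Tip≢hub p refl = hub-not-Tip p

  avoids-Tip : ∀ {x i m} → Tip x i → Avoids x (hub i) m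
  avoids-Tip p = record
    { within  = λ _ _ → λ { (inj₁ (eq , _)) → Tip≢path p eq ; (inj₂ (eq , _)) → path≢hub eq }
    ; atStart = λ _ _ → λ { (inj₁ (eq , _)) → Tip≢path p eq ; (inj₂ (eq , _)) → path≢hub eq }
    ; atEnd   = λ _ _ → λ { (inj₁ (eq , _)) → Tip≢path p eq ; (inj₂ (eq , _)) → path≢hub eq }
    }

  hub-hub : ∀ {i j} → hub i ~ hub j → Certificate G (hub i) (hub j)
  hub-hub {i} i~j = standardCertificate (cut z≤n) i~j avoids-hub-hub
    (λ p → λ { (inj₁ (eq , _)) → Tip≢hub p (sym eq) ; (inj₂ (eq , _)) → Tip≢hub p (sym eq) })
    (inj₁ i , inj₁ refl)

  path-path : ∀ {i j} → suc (toℕ i) ≡ toℕ j → Certificate G (path i) (path j)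
  path-path {i} {j} i+1≡j = standardCertificate c (path~path (inj₁ i+1≡j))
    (record
      { within  = λ where
          _     j≢m (inj₁ (_ , eq′)) → j≢m (cong toℕ (path-injective eq′))
          cons  _   (inj₂ (eq , eq′)) →
            j+1≢i (subst₂ (λ p q → suc (toℕ p) ≡ toℕ q)
                     (path-injective eq) (path-injective eq′) cons)
      ; atStart = λ _ _ → λ { (inj₁ (_ , eq)) → path≢hub (sym eq)
                          ; (inj₂ (_ , eq)) → path≢hub (sym eq) }
      ; atEnd   = λ _ _ → λ { (inj₁ (_ , eq)) → path≢hub (sym eq)
                          ; (inj₂ (_ , eq)) → path≢hub (sym eq) }
      })
    (λ p → λ { (inj₁ (eq , _)) → Tip≢path p (sym eq) ; (inj₂ (eq , _)) → Tip≢path p (sym eq) })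
    hits
    where
    c : Cut t k (toℕ j)
    -- An edge of the path is numbered by its right end, here `j`.
    c = cut (ℕ.<⇒≤ (toℕ<n j))

    j+1≢i : suc (toℕ j) ≢ toℕ i
    j+1≢i eq = ℕ.<-asym (ℕ.≤-reflexive eq) (ℕ.≤-reflexive i+1≡j)

    hits : ∃[ l ] (standard c l ≡ path i ⊎ standard c l ≡ path j)
    hits with Cut.touches c
    ... | inj₁ j≡0 = contradiction (trans i+1≡j j≡0) λ ()
    ... | inj₂ (inj₁ j≡t) = contradiction j≡t (ℕ.<⇒≢ (toℕ<n j))
    ... | inj₂ (inj₂ (q , inj₁ eq)) = inj₂ q , inj₂ (cong path (toℕ-injective eq))
    ... | inj₂ (inj₂ (q , inj₂ eq)) =
      inj₂ q , inj₁ (cong path (toℕ-injective (ℕ.suc-injective (trans eq (sym i+1≡j)))))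

  hub-path : ∀ {i j} → hub i ~ path j → Certificate G (hub i) (path j)
  hub-path {i} {j} i~j with path~hub⁻ (~-sym i~j)
  ... | inj₁ (refl , j≡0) = standardCertificate (cut z≤n) i~j
    (record
      { within  = λ _ _ → λ { (inj₁ (eq , _)) → path≢hub eq ; (inj₂ (_ , eq)) → path≢hub eq }
      ; atStart = λ _ 0≢0 → contradiction refl 0≢0
      -- For `t = 1` the edges to `u` and `v` share their path vertex; only `first≢last` tells them
      -- apart.
      ; atEnd   = λ _ _ → λ { (inj₁ (eq , _)) → path≢hub eq
                          ; (inj₂ (_ , eq)) → first≢last (sym (hub-injective eq)) }
      })
    (λ p → λ { (inj₁ (eq , _)) → Tip≢hub p (sym eq) ; (inj₂ (eq , _)) → Tip≢path p (sym eq) })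
    (inj₁ first , inj₁ refl)
  ... | inj₂ (refl , j+1≡t) = standardCertificate (cut ℕ.≤-refl) i~j
    (record
      { within  = λ _ _ → λ { (inj₁ (eq , _)) → path≢hub eq ; (inj₂ (_ , eq)) → path≢hub eq }
      ; atStart = λ _ _ → λ { (inj₁ (eq , _)) → path≢hub eq
                          ; (inj₂ (_ , eq)) → first≢last (hub-injective eq) }
      ; atEnd   = λ _ t≢t → contradiction refl t≢t
      })
    (λ p → λ { (inj₁ (eq , _)) → Tip≢hub p (sym eq) ; (inj₂ (eq , _)) → Tip≢path p (sym eq) })
    (inj₁ last , inj₁ refl)

  notTip-edge : ∀ {l i x j} → Tip l i → Tip x j → x ≢ l → ¬ SameEdge G l (hub i) x (hub j)
  notTip-edge p q x≢l (inj₁ (eq , _)) = x≢l eq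
  notTip-edge p q x≢l (inj₂ (eq , _)) = Tip≢hub q (sym eq)

  -- Deleting the edge isolates `l`, so `l` enters both the packing and the family, while `l′` still
  -- witnesses that `hub i` or one of its leaves is required.
  doubleTip : ∀ {l l′ i} → Tip l i → Tip l′ i → l′ ≢ l → Certificate G l (hub i)
  doubleTip {l} {l′} {i} p p′ l′≢l = record
    { enumerated = ↔-sym 1↔⊤ ⊎-enum pieces
    ; packed     = packed
    ; packing    = λ {c} {d} → packing c d
    -- Vacuous, as packed vertices are tips or path vertices and never hubs.
    ; apart      = λ {_} {d} _ eq → contradiction eq (packed≢hub d)
    ; family     = family
    ; dominates  = dominates
    ; touches    = inj₁ Unit.tt , inj₁ refl
    }
    where
    -- The default tip of `hub i` may be `l` itself, hence the switch to `l′`.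
    tip′ : Hub → Vertex
    tip′ j with j ≟ʰ i
    ... | yes _ = l′
    ... | no _  = tip j

    tip′-Tip : ∀ j → Tip (tip′ j) j
    tip′-Tip j with j ≟ʰ i
    ... | yes refl = p′
    ... | no _     = tip-Tip j

    tip′≢l : ∀ j → tip′ j ≢ l
    tip′≢l j eq with j ≟ʰ i
    ... | yes _  = l′≢l eq
    ... | no j≢i = j≢i (Tip-hub-unique (subst (λ x → Tip x j) eq (tip-Tip j)) p)

    packed family : Unit.⊤ ⊎ Piece → Vertex
    packed = Sum.[ (λ _ → l) , witness tip′-Tip ]
    family = Sum.[ (λ _ → l) , standard (cut z≤n) ]

    packed≢hub : ∀ c {j} → packed c ≢ hub j
    packed≢hub (inj₁ _) eq = Tip≢hub p (sym eq)
    packed≢hub (inj₂ c) eq = witness≢hub tip′-Tip c eq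

    near-l : ∀ {z} → NearAvoiding G l (hub i) l z → z ≡ l
    near-l (inj₁ eq)            = eq
    near-l (inj₂ (l~z , ¬same)) = contradiction (inj₁ (refl , Tip-unique p l~z)) ¬same

    witness-far : ∀ c → ¬ NearAvoiding G l (hub i) (witness tip′-Tip c) l
    witness-far (inj₁ j) (inj₁ eq)      = tip′≢l j (sym eq)
    witness-far (inj₂ q) (inj₁ eq)      = Tip≢path p (sym eq)
    witness-far c        (inj₂ (w~l , _)) = witness≢hub tip′-Tip c (Tip-unique p (~-sym w~l))

    packing : ∀ c d {z} → NearAvoiding G l (hub i) (packed c) z →
              NearAvoiding G l (hub i) (packed d) z → c ≡ d
    packing (inj₁ _) (inj₁ _) _ _ = refl
    packing (inj₁ _) (inj₂ d) near near′ with refl ← near-l near =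
      contradiction near′ (witness-far d)
    packing (inj₂ c) (inj₁ _) near near′ with refl ← near-l near′ =
      contradiction near (witness-far c)
    packing (inj₂ c) (inj₂ d) near near′ =
      cong inj₂ (witness-packing tip′-Tip (forget G near) (forget G near′))

    dominates : ∀ x → ∃[ c ] NearAvoiding G l (hub i) x (family c)
    dominates x with kind x
    ... | isHub j  = inj₂ (inj₁ j) , inj₁ refl
    ... | isPath j = path-dominated (cut z≤n) (avoids-Tip p) (λ q → inj₂ (inj₂ q) , refl)
                       (λ _ → inj₂ (inj₁ first) , refl) (λ _ → inj₂ (inj₁ last) , refl) j
    ... | isTip {i = j} q with x ≟ l
    ...   | yes refl = inj₁ Unit.tt , inj₁ refl
    ...   | no x≢l   = inj₂ (inj₁ j) , inj₂ (Tip⇒~ q , notTip-edge p q x≢l)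

  -- The cut is put at `v` if `hub i` is `v`, and at `u` otherwise; the path then relies at most on
  -- the opposite end, which differs from `hub i`.
  sparing : ∀ i → ∃[ m ] (m ≤ t × (m ≢ 0 → first ≢ i) × (m ≢ t → last ≢ i))
  sparing i with last ≟ʰ i
  ... | yes refl   = t , ℕ.≤-refl , (λ _ → first≢last) , λ t≢t → contradiction refl t≢t
  ... | no last≢i  = 0 , z≤n , (λ 0≢0 → contradiction refl 0≢0) , λ _ → last≢i

  -- The leaf l replaces its support vertex, which stays dominated by a
  -- neighbouring support vertex; the cut is placed so that the path does not
  -- rely on that support vertex either.
  singleTip : ∀ {l i} → Tip l i → (∀ {x} → Tip x i → x ≡ l) → Certificate G l (hub i)
  singleTip {l} {i} p only with sparing i
  ... | m , m≤t , first≢i , last≢i = record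
    { enumerated = pieces
    ; packed     = witness tip-Tip
    ; packing    = λ near near′ → witness-packing tip-Tip (forget G near) (forget G near′)
    ; apart      = packing⇒apart G (Tip⇒~ p) (witness-packing tip-Tip)
    ; family     = family
    ; dominates  = dominates
    ; touches    = inj₁ i , inj₁ swapped
    }
    where
    c : Cut t k m
    c = cut m≤t

    replace : Hub → Vertex
    replace j with j ≟ʰ i
    ... | yes _ = l
    ... | no _  = hub j

    family : Piece → Vertex
    family = Sum.[ replace , path ∘ Cut.centre c ]

    swapped : replace i ≡ l
    swapped with i ≟ʰ i
    ... | yes _  = refl
    ... | no i≢i = contradiction refl i≢i

    kept : ∀ {j} → j ≢ i → replace j ≡ hub j
    kept {j} j≢i with j ≟ʰ i
    ... | yes j≡i = contradiction j≡i j≢i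
    ... | no _    = refl

    dominates : ∀ x → ∃[ c ] NearAvoiding G l (hub i) x (family c)
    dominates x with kind x
    dominates _ | isPath j = path-dominated c (avoids-Tip p) (λ q → inj₂ q , refl)
      (λ m≢0 → inj₁ first , kept (first≢i m≢0)) (λ m≢t → inj₁ last , kept (last≢i m≢t)) j
    dominates _ | isHub j with j ≟ʰ i
    ... | no j≢i = inj₁ j , inj₁ (kept j≢i)
    ... | yes refl = let i′ , i~i′ = hub-neighbour i in
      listed⇒near G (inj₁ i′ , kept λ i′≡i → ~-irrefl (cong hub (sym i′≡i)) i~i′) i~i′
          (λ { (inj₁ (eq , _)) → Tip≢hub p eq ; (inj₂ (_ , eq)) → Tip≢hub p eq })
    dominates x | isTip {i = j} q with j ≟ʰ i
    ... | yes refl = inj₁ i , inj₁ (trans swapped (sym (only q)))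
    ... | no j≢i = listed⇒near G (inj₁ j , kept j≢i) (Tip⇒~ q)
      (λ { (inj₁ (_ , eq)) → j≢i (hub-injective eq) ; (inj₂ (_ , eq)) → Tip≢hub p eq })

  pendant : ∀ {l i} → Tip l i → Certificate G l (hub i)
  pendant {l} {i} p with anyVertex? G (λ x → Tip? i x ×-dec ¬? (x ≟ l))
  ... | yes (l′ , p′ , l′≢l) = doubleTip p p′ l′≢l
  ... | no none = singleTip p only
    where
    only : ∀ {x} → Tip x i → x ≡ l
    only {x} q with x ≟ l
    ... | yes x≡l = x≡l
    ... | no x≢l  = contradiction (x , q , x≢l) none

  certificate : ∀ {a b} → a ~ b → Certificate G a b
  certificate {a} {b} a~b with kind a | kind b
  ... | isTip p  | _        with refl ← Tip-unique p a~b = pendant p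
  ... | isHub _  | isTip p  with refl ← hub-injective (Tip-unique p (~-sym a~b)) =
    certificate-swap G (pendant p)
  ... | isPath _ | isTip p  = contradiction (Tip-unique p (~-sym a~b)) path≢hub
  ... | isHub _  | isHub _  = hub-hub a~b
  ... | isHub _  | isPath _ = hub-path a~b
  ... | isPath _ | isHub _  = certificate-swap G (hub-path (~-sym a~b))
  ... | isPath _ | isPath _ with path~path⁻ a~b
  ...   | inj₁ i+1≡j = path-path i+1≡j
  ...   | inj₂ j+1≡i = certificate-swap G (path-path j+1≡i)

  subRemovable : ∀ (e : Edge G) → γ (deleteEdge G e) ≡ γ (subdivideEdge G e)
  subRemovable (edge a~b) = certified G a~b (certificate a~b)

-- Leaves and support vertices of a hairy graph.

module _ (H : Graph) where
  open Graph H

  -- Two different neighbours would embed `Fin 2` into a neighbour set of size 1.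
  leaf-unique : ∀ {x y z} → Leaf H x → x ~ y → x ~ z → y ≡ z
  leaf-unique {x} {y} {z} leaf x~y x~z with y ≟ z
  ... | yes y≡z = y≡z
  ... | no y≢z  = contradiction
    (subst (2 ≤_) leaf (injection⇒≤∣∣ _ pair pair-injective pair∈)) λ { (s≤s ()) }
    where
    pair : Fin 2 → Fin order
    pair zero    = index y
    pair (suc _) = index z

    pair-injective : Injective _≡_ _≡_ pair
    pair-injective {zero}     {zero}     _  = refl
    pair-injective {zero}     {suc zero} eq = contradiction (index-injective H eq) y≢z
    pair-injective {suc zero} {zero}     eq = contradiction (sym (index-injective H eq)) y≢z
    pair-injective {suc zero} {suc zero} _  = refl

    neighbour∈ : ∀ {y} → x ~ y → index y ∈ tabulate (λ i → Dec.does (x ~? vertex i))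
    neighbour∈ {y} x~y = lookup⇒[]= _ _ (trans (lookup∘tabulate _ (index y))
      (dec-true (x ~? vertex (index y)) (subst (x ~_) (sym (vertex-index y)) x~y)))

    pair∈ : ∀ i → pair i ∈ tabulate (λ i → Dec.does (x ~? vertex i))
    pair∈ zero    = neighbour∈ x~y
    pair∈ (suc _) = neighbour∈ x~z

  leaf? : U.Decidable (Leaf H)
  leaf? x = degree H x ℕ.≟ 1

  support? : U.Decidable (Support H)
  support? x = anyVertex? H (λ y → (x ~? y) ×-dec leaf? y)

  -- No edge leaves the closed neighbourhood of `c`, so by connectedness it is everything and `H` is
  -- a star. Excluding stars is the way in which a domination number of at least 2 is used.
  star⇒γ≤1 : ∀ {c} → Connected H → (∀ {y z} → c ~ y → y ~ z → z ≡ c) → γ H ≤ 1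
  star⇒γ≤1 {c} connected back =
    dominatedBy⇒γ≤ H (↔-id (Fin 1)) {f = λ _ → c} λ x → zero , near x (connected c x)
    where
    spread : ∀ {x y} → Near H x c → Star _~_ x y → Near H y c
    spread near         ε            = near
    spread (inj₁ refl)  (c~y ◅ rest) = spread (inj₂ (~-sym c~y)) rest
    spread (inj₂ x~c)   (x~y ◅ rest) = spread (inj₁ (sym (back (~-sym x~c) x~y))) rest

    near : ∀ x → Star _~_ c x → Near H x c
    near x = spread (inj₁ refl)

module Hairs (H : Graph) (connected : Connected H) (hairy : Hairy H) (2≤γ : 2 ≤ γ H) where
  open Graph H

  not-star : ∀ {c} → ¬ (∀ {y z} → c ~ y → y ~ z → z ≡ c)
  not-star back = contradiction (ℕ.≤-trans 2≤γ (star⇒γ≤1 H connected back)) λ { (s≤s ()) }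

  -- Otherwise `x` and its only neighbour are both leaves, and `H` is a single edge, which is a
  -- star.
  support-not-leaf : ∀ {x} → Support H x → ¬ Leaf H x
  support-not-leaf (y , x~y , leaf-y) leaf-x = not-star λ x~y′ y′~z →
    leaf-unique H (subst (Leaf H) (leaf-unique H leaf-x x~y x~y′) leaf-y) y′~z (~-sym x~y′)

  -- If all neighbours of `x` are leaves, `H` is a star around `x`. For a leaf this supplies its
  -- hub; for a hub it supplies the neighbour that dominates it in `singleTip`.
  support-neighbour : ∀ x → ∃[ y ] (x ~ y × Support H y)
  support-neighbour x with anyVertex? H (λ y → (x ~? y) ×-dec support? H y)
  ... | yes found = found
  ... | no none   = ⊥-elim (not-star back)
    where
    back : ∀ {y z} → x ~ y → y ~ z → z ≡ x
    back {y} x~y y~z with hairy y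
    ... | inj₁ leaf    = leaf-unique H leaf y~z (~-sym x~y)
    ... | inj₂ support = contradiction (y , x~y , support) none

  open Listing (listing (support? H ∘ vertex)) public using (size)
  open Listing (listing (support? H ∘ vertex)) using (item; injective; sound; complete)

  hub : Fin size → Vertex
  hub = vertex ∘ item

  hub-injective : ∀ {i j} → hub i ≡ hub j → i ≡ j
  hub-injective eq = injective (vertex-injective H eq)

  support-hub : ∀ {x} → Support H x → ∃[ i ] hub i ≡ x
  support-hub {x} support =
    let i , eq = complete (subst (Support H) (sym (vertex-index x)) support)
    in i , trans (cong vertex eq) (vertex-index x)

  hub-neighbour : ∀ i → ∃[ j ] hub i ~ hub j
  hub-neighbour i =
    let y , i~y , support = support-neighbour (hub i) ; j , eq = support-hub support
    in j , subst (hub i ~_) (sym eq) i~y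

  Tip : Vertex → Fin size → Set
  Tip x i = Leaf H x × x ~ hub i

  Tip? : ∀ i → U.Decidable (λ x → Tip x i)
  Tip? i x = leaf? H x ×-dec (x ~? hub i)

  tip : Fin size → Vertex
  tip i = proj₁ (sound i)

  tip-Tip : ∀ i → Tip (tip i) i
  tip-Tip i = let _ , i~y , leaf = sound i in leaf , ~-sym i~y

  hub-not-Tip : ∀ {i j} → ¬ Tip (hub j) i
  hub-not-Tip {j = j} (leaf , _) = support-not-leaf (sound j) leaf

  hub-or-Tip : ∀ x → (∃[ i ] hub i ≡ x) ⊎ (∃[ i ] Tip x i)
  hub-or-Tip x with hairy x
  ... | inj₂ support = inj₁ (support-hub support)
  ... | inj₁ leaf    = let _ , x~y , support = support-neighbour x ; i , eq = support-hub support
                       in inj₂ (i , leaf , subst (x ~_) (sym eq) x~y)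

-- Two hairy graphs joined by a path form a `HairyJoin`.

module _ (H₁ H₂ : Graph)
         (connected₁ : Connected H₁) (hairy₁ : Hairy H₁) (2≤γ₁ : 2 ≤ γ H₁)
         (connected₂ : Connected H₂) (hairy₂ : Hairy H₂) (2≤γ₂ : 2 ≤ γ H₂)
         (u : Graph.Vertex H₁) (support-u : Support H₁ u)
         (v : Graph.Vertex H₂) (support-v : Support H₂ v)
         (t : ℕ) where
  private
    module A₁ = Hairs H₁ connected₁ hairy₁ 2≤γ₁
    module A₂ = Hairs H₂ connected₂ hairy₂ 2≤γ₂

    G : Graph
    G = joinByPath t H₁ H₂ u v

    open Graph G using (Vertex; _~_)

    Hub : Set
    Hub = Fin A₁.size ⊎ Fin A₂.size

    hub : Hub → Vertex
    hub (inj₁ i) = inj₁ (A₁.hub i)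
    hub (inj₂ i) = inj₂ (inj₁ (A₂.hub i))

    Tip : Vertex → Hub → Set
    Tip (inj₁ x)        (inj₁ i) = A₁.Tip x i
    Tip (inj₂ (inj₁ x)) (inj₂ i) = A₂.Tip x i
    Tip _               _        = ⊥

    path : Fin t → Vertex
    path = inj₂ ∘ inj₂

    hub-injective : ∀ i j → hub i ≡ hub j → i ≡ j
    hub-injective (inj₁ i) (inj₁ j) eq = cong inj₁ (A₁.hub-injective (inj₁-injective eq))
    hub-injective (inj₂ i) (inj₂ j) eq =
      cong inj₂ (A₂.hub-injective (inj₁-injective (inj₂-injective eq)))

    hub-neighbour : ∀ i → ∃[ j ] hub i ~ hub j
    hub-neighbour (inj₁ i) = let j , i~j = A₁.hub-neighbour i in inj₁ j , i~j
    hub-neighbour (inj₂ i) = let j , i~j = A₂.hub-neighbour i in inj₂ j , i~j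

    Tip? : ∀ i → U.Decidable (λ x → Tip x i)
    Tip? (inj₁ i) (inj₁ x)        = A₁.Tip? i x
    Tip? (inj₁ i) (inj₂ (inj₁ x)) = no λ ()
    Tip? (inj₁ i) (inj₂ (inj₂ j)) = no λ ()
    Tip? (inj₂ i) (inj₁ x)        = no λ ()
    Tip? (inj₂ i) (inj₂ (inj₁ x)) = A₂.Tip? i x
    Tip? (inj₂ i) (inj₂ (inj₂ j)) = no λ ()

    tip : Hub → Vertex
    tip (inj₁ i) = inj₁ (A₁.tip i)
    tip (inj₂ i) = inj₂ (inj₁ (A₂.tip i))

    tip-Tip : ∀ i → Tip (tip i) i
    tip-Tip (inj₁ i) = A₁.tip-Tip i
    tip-Tip (inj₂ i) = A₂.tip-Tip i

    Tip⇒~ : ∀ x i → Tip x i → x ~ hub i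
    Tip⇒~ (inj₁ x)        (inj₁ i) (_ , x~i) = x~i
    Tip⇒~ (inj₂ (inj₁ x)) (inj₂ i) (_ , x~i) = x~i

    Tip-unique : ∀ x i z → Tip x i → x ~ z → z ≡ hub i
    Tip-unique (inj₁ x)        (inj₁ i) (inj₁ z) (leaf , x~i) x~z =
      cong inj₁ (leaf-unique H₁ leaf x~z x~i)
    -- A leaf of `H₁` with a neighbour on the path would have to be `u`, which as a support vertex
    -- is no leaf.
    Tip-unique (inj₁ x)        (inj₁ i) (inj₂ (inj₂ j)) (leaf , _) (refl , _) =
      contradiction leaf (A₁.support-not-leaf support-u)
    Tip-unique (inj₂ (inj₁ x)) (inj₂ i) (inj₂ (inj₁ z)) (leaf , x~i) x~z =
      cong (inj₂ ∘ inj₁) (leaf-unique H₂ leaf x~z x~i)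
    Tip-unique (inj₂ (inj₁ x)) (inj₂ i) (inj₂ (inj₂ j)) (leaf , _) (refl , _) =
      contradiction leaf (A₂.support-not-leaf support-v)

    hub-not-Tip : ∀ i j → ¬ Tip (hub j) i
    hub-not-Tip (inj₁ i) (inj₁ j) = A₁.hub-not-Tip
    hub-not-Tip (inj₂ i) (inj₂ j) = A₂.hub-not-Tip

    first last : Hub
    first = inj₁ (proj₁ (A₁.support-hub support-u))
    last  = inj₂ (proj₁ (A₂.support-hub support-v))

    path~hub⁻ : ∀ i {j} → path j ~ hub i →
                (i ≡ first × toℕ j ≡ 0) ⊎ (i ≡ last × suc (toℕ j) ≡ t)
    path~hub⁻ (inj₁ i) (eq , j≡0) = inj₁
      (cong inj₁ (A₁.hub-injective (trans eq (sym (proj₂ (A₁.support-hub support-u))))) , j≡0)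
    path~hub⁻ (inj₂ i) (eq , j+1≡t) = inj₂
      (cong inj₂ (A₂.hub-injective (trans eq (sym (proj₂ (A₂.support-hub support-v))))) , j+1≡t)

    kind : ∀ x → Kind hub Tip path x
    kind (inj₁ x) with A₁.hub-or-Tip x
    ... | inj₁ (i , refl) = isHub (inj₁ i)
    ... | inj₂ (i , p)    = isTip {i = inj₁ i} p
    kind (inj₂ (inj₁ x)) with A₂.hub-or-Tip x
    ... | inj₁ (i , refl) = isHub (inj₂ i)
    ... | inj₂ (i , p)    = isTip {i = inj₂ i} p
    kind (inj₂ (inj₂ j)) = isPath j

  hairyJoin : HairyJoin G t
  hairyJoin = record
    { Hub            = Hub
    ; hubs           = ↔-id _ ⊎-enum ↔-id _
    ; hub            = hub
    ; hub-injective  = hub-injective _ _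
    ; hub-neighbour  = hub-neighbour
    ; Tip            = Tip
    ; Tip?           = Tip?
    ; tip            = tip
    ; tip-Tip        = tip-Tip
    ; Tip⇒~          = Tip⇒~ _ _
    ; Tip-unique     = Tip-unique _ _ _
    ; hub-not-Tip    = λ {i} {j} → hub-not-Tip i j
    ; path           = path
    ; path-injective = inj₂-injective ∘ inj₂-injective
    ; path-not-Tip   = λ { {inj₁ _} () ; {inj₂ _} () }
    ; path≢hub       = λ { {inj₁ _} () ; {inj₂ _} () }
    ; first          = first
    ; last           = last
    ; first≢last     = λ ()
    ; path~path      = id
    ; path~first     = λ j≡0 → proj₂ (A₁.support-hub support-u) , j≡0
    ; path~last      = λ j+1≡t → proj₂ (A₂.support-hub support-v) , j+1≡t
    ; path~path⁻     = id
    ; path~hub⁻      = λ {i} → path~hub⁻ i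
    ; kind           = kind
    }

-- Connectedness and order of the join.

module _ (H₁ H₂ : Graph) (connected₁ : Connected H₁) (connected₂ : Connected H₂)
         (u : Graph.Vertex H₁) (v : Graph.Vertex H₂) (t : ℕ) where
  private
    G : Graph
    G = joinByPath t H₁ H₂ u v

    open Graph G using (_~_; ~-sym)

  -- Every vertex is linked to `u`: those of `H₂` go through `v` and down the path.
  join-connected : 1 ≤ t → Connected G
  join-connected 1≤t x y = toStart x ◅◅ reverse (λ {x} {y} → ~-sym {x} {y}) (toStart y)
    where
    fromPath : ∀ n (j : Fin t) → toℕ j ≡ n → Star _~_ (inj₂ (inj₂ j)) (inj₁ u)
    fromPath zero    j j≡0 = (refl , j≡0) ◅ ε
    fromPath (suc n) j j≡n+1 = inj₂ (trans (cong suc (toℕ-fromℕ< n<t)) (sym j≡n+1)) ◅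
      fromPath n (fromℕ< n<t) (toℕ-fromℕ< n<t)
      where
      n<t : n < t
      n<t = ℕ.<-trans (ℕ.≤-reflexive (sym j≡n+1)) (toℕ<n j)

    toStart : ∀ x → Star _~_ x (inj₁ u)
    toStart (inj₁ x)        = gmap inj₁ id (connected₁ x u)
    toStart (inj₂ (inj₂ j)) = fromPath (toℕ j) j refl
    toStart (inj₂ (inj₁ x)) = gmap (inj₂ ∘ inj₁) id (connected₂ x v) ◅◅
      (_◅_ {j = inj₂ (inj₂ final)} (refl , final+1≡t) (fromPath (toℕ final) final refl))
      where
      -- With `1 ≤ t` there is a last path vertex, the neighbour of `v`.
      maximum : ∀ {t} → 1 ≤ t → ∃[ j ] suc (toℕ {t} j) ≡ t
      maximum (s≤s {n = n} _) = fromℕ n , cong suc (toℕ-fromℕ n)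

      final : Fin t
      final = proj₁ (maximum 1≤t)

      final+1≡t : suc (toℕ final) ≡ t
      final+1≡t = proj₂ (maximum 1≤t)

  join-order≥2 : 2 ≤ Graph.order G
  join-order≥2 = ℕ.+-mono-≤ (nonempty (Graph.index H₁ u))
    (ℕ.≤-trans (nonempty (Graph.index H₂ v)) (ℕ.m≤m+n _ t))
    where
    nonempty : ∀ {n} → Fin n → 1 ≤ n
    nonempty {suc n} _ = s≤s z≤n

theorem7 : (H₁ H₂ : Graph) →
    Connected H₁ → Hairy H₁ → 2 ≤ γ H₁ →
    Connected H₂ → Hairy H₂ → 2 ≤ γ H₂ →
    (u : Graph.Vertex H₁) → Support H₁ u →
    (v : Graph.Vertex H₂) → Support H₂ v →
    (t : ℕ) → 1 ≤ t → t ≡ 1 ⊎ t % 3 ≡ 0 →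
    IsSR (joinByPath t H₁ H₂ u v)
theorem7 H₁ H₂ c₁ h₁ g₁ c₂ h₂ g₂ u su v sv t 1≤t t≡ = record
  { connected    = join-connected H₁ H₂ c₁ c₂ u v t 1≤t
  ; order≥2      = join-order≥2 H₁ H₂ c₁ c₂ u v t
  ; subRemovable = subRemovable
      (hairyJoin H₁ H₂ c₁ h₁ g₁ c₂ h₂ g₂ u su v sv t) (proj₂ (pathBlocks t≡))
  }
  where
  pathBlocks : ∀ {t} → t ≡ 1 ⊎ t % 3 ≡ 0 → ∃[ k ] Blocks t k
  pathBlocks     (inj₁ refl)  = 0 , trivialBlocks
  pathBlocks {t} (inj₂ t%3≡0) with divides k refl ← m%n≡0⇒n∣m t 3 t%3≡0 = k , blocksOfThree k
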